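{- Every essentially profinite class $\mathcal{F}$ of simple graphs which is closed under disjoint unions and closed under taking summands is homomorphism distinguishing closed. In particular, every essentially profinite class of simple graphs that is closed under taking minors and under disjoint unions is homomorphism distinguishing closed.
   Context: All graphs are finite, undirected, without multiple edges; simple means without loops. $\hom(F,G)$ is the number of homomorphisms $F\to G$. For a class $\mathcal{F}$, $G\equiv_{\mathcal{F}}H$ means $\hom(F,G)=\hom(F,H)$ for all $F\in\mathcal{F}$; $\mathrm{cl}(\mathcal{F})$ is the class of simple graphs $K$ such that for all simple $G,H$, $G\equiv_{\mathcal{F}}H$ implies $\hom(K,G)=\hom(K,H)$; $\mathcal{F}$ is homomorphism distinguishing closed if $\mathrm{cl}(\mathcal{F})=\mathcal{F}$. $\mathcal{F}$ is closed under taking summands if $F_1+F_2\in\mathcal{F}$ (disjoint union) implies $F_1,F_2\in\mathcal{F}$. For a graph $F$, $\Gamma(F)$ is the set of (isomorphism types of) connected components of $F$, and $\Gamma(\mathcal{F})=\bigcup_{F\in\mathcal{F}}\Gamma(F)$. For a graph $K$, $\mathcal{F}_K=\{F\in\mathcal{F}\mid \hom(F,K)>0\}$. $\mathcal{F}$ is essentially finite if $\Gamma(\mathcal{F})$ is finite, and essentially profinite if $\mathcal{F}_K$ is essentially finite for every graph $K$. Minors are defined as usual (subgraphs of graphs obtained by contracting edges). -}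

module Defs where

open import Data.Bool.Base using (Bool; false; T)
open import Data.Bool.Properties using (T?)
open import Data.Fin.Base using (Fin; splitAt; finToFun)
open import Data.Fin.Properties using (all?)
open import Data.List.Base using (List)
open import Data.List.Relation.Unary.Any using (Any)
open import Data.Nat.Base using (ℕ; suc; _+_; _^_; _>_)
open import Data.Product.Base using (∃; ∃₂; _×_)
open import Data.Sum.Base using (_⊎_; inj₁; inj₂)
open import Data.Vec.Base using (count; allFin)
open import Function.Bundles using (_↔_; _⇔_; Inverse)
open import Function.Definitions using (Injective; Surjective)
open import Level using (Level)
open import Relation.Binary.Construct.Closure.ReflexiveTransitive using (Star)
open import Relation.Binary.PropositionalEquality using (_≡_; _≢_; refl)
open import Relation.Nullary.Decidable using (Dec; _→-dec_)
open import Relation.Unary using (Pred; _≐_)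

private
  variable
    ℓ : Level

-- Graphs have at least one vertex.  With the null graph K₀ admitted, K₀ would
-- lie in cl 𝓕 for every 𝓕, so the empty class would not be homomorphism
-- distinguishing closed.
record SimpleGraph : Set where
  field
    pred-order : ℕ

  order : ℕ
  order = suc pred-order

  Vertex : Set
  Vertex = Fin order

  field
    adj     : Vertex → Vertex → Bool
    adj-sym : ∀ u v → adj u v ≡ adj v u
    no-loop : ∀ v → adj v v ≡ false

  Adj : Vertex → Vertex → Set
  Adj u v = T (adj u v)

open SimpleGraph public

record _≅_ (G H : SimpleGraph) : Set where
  field
    bijection : Vertex G ↔ Vertex H
    adj-≡     : ∀ u v → adj G u v ≡ adj H (Inverse.to bijection u) (Inverse.to bijection v)

infix 4 _≅_

IsHom : (F G : SimpleGraph) → (Vertex F → Vertex G) → Set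
IsHom F G f = ∀ u v → Adj F u v → Adj G (f u) (f v)

isHom? : ∀ F G f → Dec (IsHom F G f)
isHom? F G f = all? λ u → all? λ v → T? (adj F u v) →-dec T? (adj G (f u) (f v))

-- finToFun enumerates all maps Vertex F → Vertex G, each exactly once.
hom : SimpleGraph → SimpleGraph → ℕ
hom F G = count (λ i → isHom? F G (finToFun i)) (allFin (order G ^ order F))

infixr 6 _⊕_

_⊕_ : SimpleGraph → SimpleGraph → SimpleGraph
G ⊕ H = record
  { pred-order = pred-order G + order H
  ; adj        = λ u v → adj⊎ (splitAt (order G) u) (splitAt (order G) v)
  ; adj-sym    = λ u v → adj⊎-sym (splitAt (order G) u) (splitAt (order G) v)
  ; no-loop    = λ v → adj⊎-no-loop (splitAt (order G) v)
  }
  where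
  adj⊎ : Vertex G ⊎ Vertex H → Vertex G ⊎ Vertex H → Bool
  adj⊎ (inj₁ u) (inj₁ v) = adj G u v
  adj⊎ (inj₁ _) (inj₂ _) = false
  adj⊎ (inj₂ _) (inj₁ _) = false
  adj⊎ (inj₂ u) (inj₂ v) = adj H u v

  adj⊎-sym : ∀ x y → adj⊎ x y ≡ adj⊎ y x
  adj⊎-sym (inj₁ u) (inj₁ v) = adj-sym G u v
  adj⊎-sym (inj₁ _) (inj₂ _) = refl
  adj⊎-sym (inj₂ _) (inj₁ _) = refl
  adj⊎-sym (inj₂ u) (inj₂ v) = adj-sym H u v

  adj⊎-no-loop : ∀ x → adj⊎ x x ≡ false
  adj⊎-no-loop (inj₁ v) = no-loop G v
  adj⊎-no-loop (inj₂ v) = no-loop H v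

_≡[_]_ : SimpleGraph → Pred SimpleGraph ℓ → SimpleGraph → Set ℓ
G ≡[ 𝓕 ] H = ∀ F → 𝓕 F → hom F G ≡ hom F H

cl : Pred SimpleGraph ℓ → Pred SimpleGraph ℓ
cl 𝓕 K = ∀ G H → G ≡[ 𝓕 ] H → hom K G ≡ hom K H

HomDistinguishingClosed : Pred SimpleGraph ℓ → Set ℓ
HomDistinguishingClosed 𝓕 = cl 𝓕 ≐ 𝓕

ClosedUnderDisjointUnions : Pred SimpleGraph ℓ → Set ℓ
ClosedUnderDisjointUnions 𝓕 = ∀ F₁ F₂ → 𝓕 F₁ → 𝓕 F₂ → 𝓕 (F₁ ⊕ F₂)

ClosedUnderSummands : Pred SimpleGraph ℓ → Set ℓ
ClosedUnderSummands 𝓕 = ∀ F₁ F₂ → 𝓕 (F₁ ⊕ F₂) → 𝓕 F₁ × 𝓕 F₂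

-- C is isomorphic to the subgraph of F induced on the set of vertices
-- reachable from root.
record IsComponentOf (C F : SimpleGraph) : Set where
  field
    root      : Vertex F
    embed     : Vertex C → Vertex F
    injective : Injective _≡_ _≡_ embed
    induced   : ∀ u v → adj C u v ≡ adj F (embed u) (embed v)
    image     : ∀ w → Star (Adj F) root w ⇔ ∃ λ u → embed u ≡ w

Γ : Pred SimpleGraph ℓ → Pred SimpleGraph ℓ
Γ 𝓕 C = ∃ λ F → 𝓕 F × IsComponentOf C F

-- The isomorphism types in 𝓕 are exactly those of a finite list (so each entry
-- of the list lies in 𝓕 up to isomorphism).
FiniteUpToIso : Pred SimpleGraph ℓ → Set ℓ
FiniteUpToIso 𝓕 = ∃ λ (Fs : List SimpleGraph) → ∀ F → 𝓕 F ⇔ Any (F ≅_) Fs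

EssentiallyFinite : Pred SimpleGraph ℓ → Set ℓ
EssentiallyFinite 𝓕 = FiniteUpToIso (Γ 𝓕)

_mappingTo_ : Pred SimpleGraph ℓ → SimpleGraph → Pred SimpleGraph ℓ
(𝓕 mappingTo K) F = 𝓕 F × hom F K > 0

-- K has no loops: for K a single looped vertex, 𝓕 mappingTo K would be 𝓕
-- itself and the notion would collapse to EssentiallyFinite.
EssentiallyProfinite : Pred SimpleGraph ℓ → Set ℓ
EssentiallyProfinite 𝓕 = ∀ K → EssentiallyFinite (𝓕 mappingTo K)

-- G′ arises from G by identifying the ends u, v of an edge; the resulting loop
-- and parallel edges are suppressed.
record Contraction (G G′ : SimpleGraph) : Set where
  field
    {u v}      : Vertex G
    edge       : Adj G u v
    π          : Vertex G → Vertex G′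
    surjective : Surjective _≡_ _≡_ π
    kernel     : ∀ x y → π x ≡ π y ⇔ (x ≡ y ⊎ (x ≡ u × y ≡ v) ⊎ (x ≡ v × y ≡ u))
    adjacency  : ∀ a b → Adj G′ a b ⇔
                   (a ≢ b × ∃₂ λ x y → Adj G x y × π x ≡ a × π y ≡ b)

record IsSubgraphOf (H G : SimpleGraph) : Set where
  field
    embed     : Vertex H → Vertex G
    injective : Injective _≡_ _≡_ embed
    isHom     : IsHom H G embed

IsMinorOf : SimpleGraph → SimpleGraph → Set
IsMinorOf M G = ∃ λ G′ → Star Contraction G G′ × IsSubgraphOf M G′

ClosedUnderMinors : Pred SimpleGraph ℓ → Set ℓ
ClosedUnderMinors 𝓕 = ∀ M G → IsMinorOf M G → 𝓕 G → 𝓕 M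

module Submission where

-- Let C₁, …, Cₖ be the finitely many components occurring in 𝓕_K, and suppose that a
-- component L of K is none of them.  For connected D the map hom D (−) turns ⊕ into + and ⊗
-- into ·, and by Lovász's theorem there is a graph A with hom D A ≠ hom L A whenever D ≇ L.
-- The product of the "factors" A − hom D A, over all D ≇ L among the Cᵢ and the components of
-- K, thus yields two graphs T₊, T₋ agreeing on all these D but not on L.  Then (T₊ ⊕ K) ⊗ K and
-- (T₋ ⊕ K) ⊗ K agree on 𝓕 but not on K: the summand K makes the contribution of the other
-- components of K non-zero, and the factor K takes care of the F ∈ 𝓕 with hom F K = 0.
-- Hence if K ∈ cl 𝓕, then every component of K occurs in 𝓕_K, and K ∈ 𝓕.

open import Defs
open import Data.Bool.Base using (true; false; T; _∧_)
open import Data.Bool.Properties using (T?; T-∧)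
open import Data.Empty using (⊥-elim)
open import Data.Fin.Base using (Fin; zero; suc; toℕ; _↑ˡ_; _↑ʳ_; splitAt; join; combine; remQuot; finToFun; funToFin)
open import Data.Fin.Permutation using (↔⇒≡)
open import Data.Fin.Properties
  using (_≟_; any?; pigeonhole; suc-injective; ↑ˡ-injective; ↑ʳ-injective; splitAt-↑ˡ; splitAt-↑ʳ; join-splitAt;
         combine-injective; combine-surjective; remQuot-combine; combine-remQuot; finToFun-funToFin; funToFin-finToFin)
open import Data.Fin.Subset using (Subset; ⁅_⁆; _∪_; _⊃_) renaming (_∈_ to _∈ₛ_)
open import Data.Fin.Subset.Induction using (⊃-wellFounded; Acc; acc)
open import Data.Fin.Subset.Properties using (x∈⁅x⁆; x∈⁅y⁆⇒x≡y; p⊆p∪q; x∈p∪q⁺; x∈p∪q⁻) renaming (_∈?_ to _∈ₛ?_)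
open import Data.List.Base as List using (List; []; _∷_)
open import Data.List.Membership.Propositional using (_∈_; find)
open import Data.List.Membership.Propositional.Properties using (∈-allFin)
open import Data.List.Properties using (map-cong-local)
open import Data.List.Relation.Unary.All as All using (All; []; _∷_)
import Data.List.Relation.Unary.All.Properties as All
open import Data.List.Relation.Unary.Any as Any using (Any; here; there)
open import Data.Nat.Base using (ℕ; zero; suc; _+_; _*_; _^_; _<_; _≤_; z<s; s<s⁻¹; s≤s; >-nonZero)
open import Data.Nat.GeneralisedArithmetic using (fold)
open import Data.Nat.Induction using (<-wellFounded)
open import Data.Nat.ListAction using (product)
import Data.Nat.Properties as ℕ
open import Data.Nat.Tactic.RingSolver using (solve-∀)
open import Data.Product.Base using (∃; ∃₂; _×_; _,_; proj₁; proj₂; uncurry)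
open import Data.Product.Function.NonDependent.Setoid using (_×-inverse_)
open import Data.Product.Relation.Binary.Pointwise.NonDependent using (_×ₛ_)
open import Data.Sum.Base as Sum using (_⊎_; inj₁; inj₂; [_,_]′)
open import Data.Sum.Function.Setoid using (_⊎-inverse_)
open import Data.Sum.Relation.Binary.Pointwise using (_⊎ₛ_; inj₁; inj₂)
open import Data.Vec.Base using (count; allFin; tabulate)
open import Function.Base using (_∘_; id)
open import Function.Bundles using (Inverse; Equivalence; _⇔_; mk⇔; mk↔ₛ′)
open import Function.Construct.Composition using () renaming (inverse to infixr 5 _⨾_)
open import Function.Construct.Symmetry using () renaming (inverse to ≃-sym)
open import Function.Definitions using (Congruent; Injective)
open import Function.Properties.Bijection using (Bijection⇒Inverse)
open import Level using (Level; 0ℓ)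
open import Relation.Binary.Bundles using (Setoid)
open import Relation.Binary.Construct.Closure.ReflexiveTransitive using (Star; ε; _◅_; _◅◅_; gmap)
import Relation.Binary.Construct.On as On
open import Relation.Binary.Definitions using (_Respects_; tri<; tri≈; tri>)
open import Relation.Binary.PropositionalEquality
  using (_≡_; _≢_; _≗_; refl; sym; trans; cong; cong₂; subst; subst₂; _→-setoid_; setoid; module ≡-Reasoning)
open import Relation.Nullary using (¬_; Dec; ¬?; _×-dec_; yes; no; contradiction)
open import Relation.Nullary.Decidable using (decidable-stable)
open import Relation.Unary using (Pred; Decidable)

private
  variable
    ℓ : Level
    m n : ℕ

-- Counting by bijections between setoids.

infix 3 _≃_

_≃_ : Setoid 0ℓ 0ℓ → Setoid 0ℓ 0ℓ → Set
_≃_ = Inverse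

⟦_⟧ : ℕ → Setoid 0ℓ 0ℓ
⟦ n ⟧ = setoid (Fin n)

bijective⇒≃ : (S T : Setoid 0ℓ 0ℓ) →
  let open Setoid S using () renaming (Carrier to A; _≈_ to _≈₁_)
      open Setoid T using () renaming (Carrier to B; _≈_ to _≈₂_)
  in (f : A → B) → Congruent _≈₁_ _≈₂_ f → Injective _≈₁_ _≈₂_ f →
     (∀ y → ∃ λ x → f x ≈₂ y) → S ≃ T
bijective⇒≃ S T f f-cong f-inj f-surj = Bijection⇒Inverse record
  { to        = f
  ; cong      = f-cong
  ; bijective = f-inj , λ y → let x , fx≈y = f-surj y in x , λ z≈x → Setoid.trans T (f-cong z≈x) fx≈y
  }

⟦⟧-injective : ⟦ m ⟧ ≃ ⟦ n ⟧ → m ≡ n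
⟦⟧-injective = ↔⇒≡

⟦⟧-× : ⟦ m ⟧ ×ₛ ⟦ n ⟧ ≃ ⟦ m * n ⟧
⟦⟧-× {m} {n} = bijective⇒≃ (⟦ m ⟧ ×ₛ ⟦ n ⟧) ⟦ m * n ⟧ (uncurry combine)
  (uncurry (cong₂ combine))
  (combine-injective _ _ _ _)
  (λ k → let i , j , eq = combine-surjective {m} k in (i , j) , eq)

↑ˡ≢↑ʳ : {i : Fin m} {j : Fin n} → i ↑ˡ n ≢ m ↑ʳ j
↑ˡ≢↑ʳ {m} {n} {i} {j} eq
  with () ← trans (trans (sym (splitAt-↑ˡ m i n)) (cong (splitAt m) eq)) (splitAt-↑ʳ m n j)

⟦⟧-⊎ : ⟦ m ⟧ ⊎ₛ ⟦ n ⟧ ≃ ⟦ m + n ⟧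
⟦⟧-⊎ {m} {n} = bijective⇒≃ (⟦ m ⟧ ⊎ₛ ⟦ n ⟧) ⟦ m + n ⟧ (join m n)
  (λ { (inj₁ refl) → refl ; (inj₂ refl) → refl })
  join-injective
  (λ k → splitAt m k , join-splitAt m n k)
  where
  join-injective : Injective (Setoid._≈_ (⟦ m ⟧ ⊎ₛ ⟦ n ⟧)) _≡_ (join m n)
  join-injective {inj₁ _} {inj₁ _} eq = inj₁ (↑ˡ-injective n _ _ eq)
  join-injective {inj₁ _} {inj₂ _} eq = ⊥-elim (↑ˡ≢↑ʳ eq)
  join-injective {inj₂ _} {inj₁ _} eq = ⊥-elim (↑ˡ≢↑ʳ (sym eq))
  join-injective {inj₂ _} {inj₂ _} eq = inj₂ (↑ʳ-injective m _ _ eq)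

-- Two elements are equal as soon as their first components are; the witnesses of `P` are ignored,
-- so that each element is counted once however many proofs it has.
Sub : (S : Setoid 0ℓ 0ℓ) → Pred (Setoid.Carrier S) 0ℓ → Setoid 0ℓ 0ℓ
Sub S P = On.setoid {B = ∃ P} S proj₁

-- Stated for an arbitrary `f` rather than for `allFin n`, because the tail of `tabulate f` is
-- `tabulate (f ∘ suc)` and the induction needs that instance.
count-tabulate : {A : Set} {P : Pred A 0ℓ} (P? : Decidable P) (f : Fin n → A) →
  Sub ⟦ n ⟧ (P ∘ f) ≃ ⟦ count P? (tabulate f) ⟧
count-tabulate {n = zero} {P = P} P? f =
  bijective⇒≃ (Sub ⟦ 0 ⟧ (P ∘ f)) ⟦ 0 ⟧ (λ { (() , _) }) (λ { {() , _} }) (λ { {() , _} }) (λ ())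
count-tabulate {n = suc n} {P = P} P? f with P? (f zero) | count-tabulate P? (f ∘ suc)
... | yes p₀ | rest = bijective⇒≃ (Sub ⟦ suc n ⟧ (P ∘ f)) _ to to-cong to-inj to-surj
  where
  module R = Inverse rest
  to : ∃ (P ∘ f) → Fin _
  to (zero , _)  = zero
  to (suc i , q) = suc (R.to (i , q))
  to-cong : ∀ {x y} → proj₁ x ≡ proj₁ y → to x ≡ to y
  to-cong {zero , _}  {zero , _}  _  = refl
  to-cong {suc _ , _} {suc _ , _} eq = cong suc (R.to-cong (suc-injective eq))
  to-inj : ∀ {x y} → to x ≡ to y → proj₁ x ≡ proj₁ y
  to-inj {zero , _}  {zero , _}  _  = refl
  to-inj {suc _ , _} {suc _ , _} eq =
    cong suc (trans (sym (R.strictlyInverseʳ _)) (trans (R.from-cong (suc-injective eq)) (R.strictlyInverseʳ _)))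
  to-surj : ∀ j → ∃ λ x → to x ≡ j
  to-surj zero    = (zero , p₀) , refl
  to-surj (suc j) = (suc (proj₁ (R.from j)) , proj₂ (R.from j)) , cong suc (R.strictlyInverseˡ j)
... | no ¬p₀ | rest = bijective⇒≃ (Sub ⟦ suc n ⟧ (P ∘ f)) _ to to-cong to-inj to-surj
  where
  module R = Inverse rest
  to : ∃ (P ∘ f) → Fin _
  to (zero , p₀) = contradiction p₀ ¬p₀
  to (suc i , q) = R.to (i , q)
  to-cong : ∀ {x y} → proj₁ x ≡ proj₁ y → to x ≡ to y
  to-cong {zero , p₀} {_}         _  = contradiction p₀ ¬p₀
  to-cong {suc _ , _} {suc _ , _} eq = R.to-cong (suc-injective eq)
  to-inj : ∀ {x y} → to x ≡ to y → proj₁ x ≡ proj₁ y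
  to-inj {zero , p₀}  {_}         _  = contradiction p₀ ¬p₀
  to-inj {suc _ , _}  {zero , p₀} _  = contradiction p₀ ¬p₀
  to-inj {suc _ , _}  {suc _ , _} eq =
    cong suc (trans (sym (R.strictlyInverseʳ _)) (trans (R.from-cong eq) (R.strictlyInverseʳ _)))
  to-surj : ∀ j → ∃ λ x → to x ≡ j
  to-surj j = (suc (proj₁ (R.from j)) , proj₂ (R.from j)) , R.strictlyInverseˡ j

Maps : {R : Pred (Fin m → Fin n) 0ℓ} → Decidable R → Setoid 0ℓ 0ℓ
Maps {m} {n} {R} R? = Sub (Fin m →-setoid Fin n) R

-- At `isHom? F G` this is `hom F G` by definition, so every rule for this count is a rule for
-- homomorphism numbers; it also covers homomorphisms with a prescribed image.
#_ : {R : Pred (Fin m → Fin n) 0ℓ} → Decidable R → ℕ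
#_ {m} {n} R? = count (λ i → R? (finToFun i)) (allFin (n ^ m))

#-card : {R : Pred (Fin m → Fin n) 0ℓ} (R? : Decidable R) → R Respects _≗_ → Maps R? ≃ ⟦ # R? ⟧
#-card {m} {n} {R} R? resp = ≃-sym enumerate ⨾ count-tabulate (R? ∘ finToFun) id
  where
  enumerate : Sub ⟦ n ^ m ⟧ (R ∘ finToFun) ≃ Maps R?
  enumerate = bijective⇒≃ (Sub ⟦ n ^ m ⟧ (R ∘ finToFun)) (Maps R?) (λ (i , r) → finToFun i , r)
    (λ { refl _ → refl })
    (λ eq → trans (sym (funToFin-finToFin {m} _)) (trans (funToFin-cong eq) (funToFin-finToFin {m} _)))
    -- Decoding the code of `f` returns `f` only up to pointwise equality; this is where `R` must
    -- respect `_≗_`.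
    (λ (f , r) → (funToFin f , resp (sym ∘ finToFun-funToFin f) r) , finToFun-funToFin f)
    where
    funToFin-cong : ∀ {k} {f g : Fin k → Fin n} → f ≗ g → funToFin f ≡ funToFin g
    funToFin-cong {zero}  _   = refl
    funToFin-cong {suc _} f≗g = cong₂ combine (f≗g zero) (funToFin-cong (f≗g ∘ suc))

#-⊎ : ∀ {m′ n′ m″ n″} {R : Pred (Fin m → Fin n) 0ℓ} {R′ : Pred (Fin m′ → Fin n′) 0ℓ} {R″ : Pred (Fin m″ → Fin n″) 0ℓ}
  (R? : Decidable R) (R′? : Decidable R′) (R″? : Decidable R″) →
  R Respects _≗_ → R′ Respects _≗_ → R″ Respects _≗_ →
  Maps R? ⊎ₛ Maps R′? ≃ Maps R″? → # R″? ≡ # R? + # R′?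
#-⊎ R? R′? R″? resp resp′ resp″ e = ⟦⟧-injective
  (≃-sym (#-card R″? resp″) ⨾ ≃-sym e ⨾ (#-card R? resp ⊎-inverse #-card R′? resp′) ⨾ ⟦⟧-⊎)

#-× : ∀ {m′ n′ m″ n″} {R : Pred (Fin m → Fin n) 0ℓ} {R′ : Pred (Fin m′ → Fin n′) 0ℓ} {R″ : Pred (Fin m″ → Fin n″) 0ℓ}
  (R? : Decidable R) (R′? : Decidable R′) (R″? : Decidable R″) →
  R Respects _≗_ → R′ Respects _≗_ → R″ Respects _≗_ →
  Maps R″? ≃ Maps R? ×ₛ Maps R′? → # R″? ≡ # R? * # R′?
#-× R? R′? R″? resp resp′ resp″ e = ⟦⟧-injective
  (≃-sym (#-card R″? resp″) ⨾ e ⨾ (#-card R? resp ×-inverse #-card R′? resp′) ⨾ ⟦⟧-×)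

#-≃ : ∀ {m′ n′} {R : Pred (Fin m → Fin n) 0ℓ} {R′ : Pred (Fin m′ → Fin n′) 0ℓ}
  (R? : Decidable R) (R′? : Decidable R′) →
  R Respects _≗_ → R′ Respects _≗_ → Maps R? ≃ Maps R′? → # R? ≡ # R′?
#-≃ R? R′? resp resp′ e = ⟦⟧-injective (≃-sym (#-card R? resp) ⨾ e ⨾ #-card R′? resp′)

#-positive : {R : Pred (Fin m → Fin n) 0ℓ} (R? : Decidable R) → R Respects _≗_ → ∃ R → 0 < # R?
#-positive R? resp fr with # R? | #-card R? resp
... | zero  | e with () ← Inverse.to e fr
... | suc _ | _ = z<s

#-witness : {R : Pred (Fin m → Fin n) 0ℓ} (R? : Decidable R) → R Respects _≗_ → 0 < # R? → ∃ R
#-witness R? resp 0<# with # R? | #-card R? resp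
... | suc _ | e = Inverse.from e zero

-- Homomorphism numbers of disjoint unions and products.

isHom-resp : ∀ F G → IsHom F G Respects _≗_
isHom-resp F G f≗g f-hom u v e = subst₂ (Adj G) (f≗g u) (f≗g v) (f-hom u v e)

Hom : SimpleGraph → SimpleGraph → Setoid 0ℓ 0ℓ
Hom F G = Maps (isHom? F G)

-- Matching on this view replaces the vertex itself by `u ↑ˡ n` or `m ↑ʳ v`, the forms in which the
-- adjacency equations of `_⊕_` are stated.
data ⊕-View {m n} : Fin (m + n) → Set where
  left  : ∀ u → ⊕-View (u ↑ˡ n)
  right : ∀ v → ⊕-View (m ↑ʳ v)

⊕-view : ∀ m {n} (i : Fin (m + n)) → ⊕-View {m} {n} i
⊕-view m {n} i = subst ⊕-View (join-splitAt m n i) (view (splitAt m i))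
  where
  view : ∀ x → ⊕-View (join m n x)
  view (inj₁ u) = left u
  view (inj₂ v) = right v

module _ (G H : SimpleGraph) where
  private
    l : Vertex G → Vertex (G ⊕ H)
    l = _↑ˡ order H
    r : Vertex H → Vertex (G ⊕ H)
    r = order G ↑ʳ_

  adj-⊕-ll : ∀ u v → adj (G ⊕ H) (l u) (l v) ≡ adj G u v
  adj-⊕-ll u v rewrite splitAt-↑ˡ (order G) u (order H) | splitAt-↑ˡ (order G) v (order H) = refl

  adj-⊕-lr : ∀ u v → adj (G ⊕ H) (l u) (r v) ≡ false
  adj-⊕-lr u v rewrite splitAt-↑ˡ (order G) u (order H) | splitAt-↑ʳ (order G) (order H) v = refl

  adj-⊕-rl : ∀ u v → adj (G ⊕ H) (r u) (l v) ≡ false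
  adj-⊕-rl u v = trans (adj-sym (G ⊕ H) (r u) (l v)) (adj-⊕-lr v u)

  adj-⊕-rr : ∀ u v → adj (G ⊕ H) (r u) (r v) ≡ adj H u v
  adj-⊕-rr u v rewrite splitAt-↑ʳ (order G) (order H) u | splitAt-↑ʳ (order G) (order H) v = refl

isHom-inˡ : ∀ G H → IsHom G (G ⊕ H) (_↑ˡ order H)
isHom-inˡ G H u v = subst T (sym (adj-⊕-ll G H u v))

isHom-inʳ : ∀ G H → IsHom H (G ⊕ H) (order G ↑ʳ_)
isHom-inʳ G H u v = subst T (sym (adj-⊕-rr G H u v))

module _ {X : Set} (f : Fin m → X) (g : Fin n → X) where

  copair : Fin (m + n) → X
  copair = [ f , g ]′ ∘ splitAt m

  copair-↑ˡ : ∀ u → copair (u ↑ˡ n) ≡ f u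
  copair-↑ˡ u = cong [ f , g ]′ (splitAt-↑ˡ m u n)

  copair-↑ʳ : ∀ v → copair (m ↑ʳ v) ≡ g v
  copair-↑ʳ v = cong [ f , g ]′ (splitAt-↑ʳ m n v)

isHom-copair : ∀ F F′ G {f g} → IsHom F G f → IsHom F′ G g → IsHom (F ⊕ F′) G (copair f g)
isHom-copair F F′ G {f} {g} f-hom g-hom i j e with ⊕-view (order F) i | ⊕-view (order F) j
... | left u  | left v  = subst₂ (Adj G) (sym (copair-↑ˡ f g u)) (sym (copair-↑ˡ f g v))
                            (f-hom u v (subst T (adj-⊕-ll F F′ u v) e))
... | left u  | right v = ⊥-elim (subst T (adj-⊕-lr F F′ u v) e)
... | right u | left v  = ⊥-elim (subst T (adj-⊕-rl F F′ u v) e)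
... | right u | right v = subst₂ (Adj G) (sym (copair-↑ʳ f g u)) (sym (copair-↑ʳ f g v))
                            (g-hom u v (subst T (adj-⊕-rr F F′ u v) e))

-- Universal property of the coproduct: a homomorphism out of a disjoint union is determined by its
-- two restrictions, which may be chosen independently.
hom-⊕-source : ∀ F F′ G → hom (F ⊕ F′) G ≡ hom F G * hom F′ G
hom-⊕-source F F′ G = #-× (isHom? F G) (isHom? F′ G) (isHom? (F ⊕ F′) G)
  (isHom-resp F G) (isHom-resp F′ G) (isHom-resp (F ⊕ F′) G)
  (bijective⇒≃ (Hom (F ⊕ F′) G) (Hom F G ×ₛ Hom F′ G)
    (λ (h , h-hom) → (h ∘ (_↑ˡ order F′) , λ u v → h-hom _ _ ∘ isHom-inˡ F F′ u v)
                   , (h ∘ (order F ↑ʳ_) , λ u v → h-hom _ _ ∘ isHom-inʳ F F′ u v))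
    (λ eq → eq ∘ (_↑ˡ order F′) , eq ∘ (order F ↑ʳ_))
    (λ (eqˡ , eqʳ) i → jointly-injective eqˡ eqʳ i)
    (λ ((f , f-hom) , (g , g-hom)) →
      (copair f g , isHom-copair F F′ G f-hom g-hom) , copair-↑ˡ f g , copair-↑ʳ f g))
  where
  jointly-injective : ∀ {h k : Vertex (F ⊕ F′) → Vertex G} →
    h ∘ (_↑ˡ order F′) ≗ k ∘ (_↑ˡ order F′) → h ∘ (order F ↑ʳ_) ≗ k ∘ (order F ↑ʳ_) → h ≗ k
  jointly-injective eqˡ eqʳ i with ⊕-view (order F) i
  ... | left u  = eqˡ u
  ... | right v = eqʳ v

infixr 7 _⊗_

-- The categorical product of graphs, with pairs of vertices coded by `combine`.
_⊗_ : SimpleGraph → SimpleGraph → SimpleGraph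
G ⊗ H = record
  -- Chosen so that `order` computes to `order G * order H`, the size that `remQuot` expects.
  { pred-order = pred-order H + pred-order G * order H
  ; adj        = λ i j → adj G (π₁ i) (π₁ j) ∧ adj H (π₂ i) (π₂ j)
  ; adj-sym    = λ i j → cong₂ _∧_ (adj-sym G (π₁ i) (π₁ j)) (adj-sym H (π₂ i) (π₂ j))
  ; no-loop    = λ i → cong (_∧ adj H (π₂ i) (π₂ i)) (no-loop G (π₁ i))
  }
  where
  π₁ : Fin (order G * order H) → Vertex G
  π₁ i = proj₁ (remQuot {order G} (order H) i)
  π₂ : Fin (order G * order H) → Vertex H
  π₂ i = proj₂ (remQuot {order G} (order H) i)

-- Universal property of the product: pairing and projecting are mutually inverse.
hom-⊗ : ∀ F G H → hom F (G ⊗ H) ≡ hom F G * hom F H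
hom-⊗ F G H = #-× (isHom? F G) (isHom? F H) (isHom? F (G ⊗ H)) (isHom-resp F G) (isHom-resp F H) (isHom-resp F (G ⊗ H))
  (bijective⇒≃ (Hom F (G ⊗ H)) (Hom F G ×ₛ Hom F H)
    (λ (h , h-hom) → (proj₁ ∘ rq ∘ h , λ u v → proj₁ ∘ Equivalence.to T-∧ ∘ h-hom u v)
                   , (proj₂ ∘ rq ∘ h , λ u v → proj₂ ∘ Equivalence.to T-∧ ∘ h-hom u v))
    (λ eq → cong (proj₁ ∘ rq) ∘ eq , cong (proj₂ ∘ rq) ∘ eq)
    (λ {(h , _)} {(k , _)} (eq₁ , eq₂) u → trans (sym (combine-remQuot (order H) (h u)))
       (trans (cong₂ combine (eq₁ u) (eq₂ u)) (combine-remQuot (order H) (k u))))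
    (λ ((f , f-hom) , (g , g-hom)) →
        ((λ u → combine (f u) (g u)) , λ u v e → Equivalence.from T-∧
          ( subst₂ (Adj G) (sym (rq-combine₁ (f u) (g u))) (sym (rq-combine₁ (f v) (g v))) (f-hom u v e)
          , subst₂ (Adj H) (sym (rq-combine₂ (f u) (g u))) (sym (rq-combine₂ (f v) (g v))) (g-hom u v e)))
      , (λ u → rq-combine₁ (f u) (g u)) , (λ u → rq-combine₂ (f u) (g u))))
  where
  rq : Vertex (G ⊗ H) → Vertex G × Vertex H
  rq = remQuot {order G} (order H)
  rq-combine₁ : ∀ u v → proj₁ (rq (combine u v)) ≡ u
  rq-combine₁ u v = cong proj₁ (remQuot-combine {order G} u v)
  rq-combine₂ : ∀ u v → proj₂ (rq (combine u v)) ≡ v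
  rq-combine₂ u v = cong proj₂ (remQuot-combine {order G} u v)

Connected : SimpleGraph → Set
Connected F = ∃ λ root → ∀ v → Star (Adj F) root v

-- No edge joins the two sides of `G ⊕ H`, so along walks from the root the whole image of `F` stays
-- on the side of the image of the root.
hom-⊕-target : ∀ F → Connected F → ∀ G H → hom F (G ⊕ H) ≡ hom F G + hom F H
hom-⊕-target F (root , reach) G H = #-⊎ (isHom? F G) (isHom? F H) (isHom? F (G ⊕ H))
  (isHom-resp F G) (isHom-resp F H) (isHom-resp F (G ⊕ H))
  (bijective⇒≃ (Hom F G ⊎ₛ Hom F H) (Hom F (G ⊕ H)) inject inject-cong inject-injective inject-surjective)
  where
  module G⊎H = Setoid (Hom F G ⊎ₛ Hom F H)
  module G⊕H = Setoid (Hom F (G ⊕ H))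

  inject : G⊎H.Carrier → G⊕H.Carrier
  inject (inj₁ (f , f-hom)) = (_↑ˡ order H) ∘ f , λ u v → isHom-inˡ G H (f u) (f v) ∘ f-hom u v
  inject (inj₂ (g , g-hom)) = (order G ↑ʳ_) ∘ g , λ u v → isHom-inʳ G H (g u) (g v) ∘ g-hom u v

  inject-cong : Congruent G⊎H._≈_ G⊕H._≈_ inject
  inject-cong (inj₁ eq) = cong (_↑ˡ order H) ∘ eq
  inject-cong (inj₂ eq) = cong (order G ↑ʳ_) ∘ eq

  inject-injective : Injective G⊎H._≈_ G⊕H._≈_ inject
  inject-injective {inj₁ _} {inj₁ _} eq = inj₁ (↑ˡ-injective (order H) _ _ ∘ eq)
  inject-injective {inj₁ _} {inj₂ _} eq = ⊥-elim (↑ˡ≢↑ʳ (eq root))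
  inject-injective {inj₂ _} {inj₁ _} eq = ⊥-elim (↑ˡ≢↑ʳ (sym (eq root)))
  inject-injective {inj₂ _} {inj₂ _} eq = inj₂ (↑ʳ-injective (order G) _ _ ∘ eq)

  module _ {h : Vertex F → Vertex (G ⊕ H)} (h-hom : IsHom F (G ⊕ H) h) where

    stays-left : ∀ {u v} → Star (Adj F) u v → (∃ λ x → x ↑ˡ order H ≡ h u) → ∃ λ y → y ↑ˡ order H ≡ h v
    stays-left ε hit = hit
    stays-left {u} (_◅_ {j = w} e es) (x , x≡) = stays-left es (step (h w) refl)
      where
      step : ∀ i → i ≡ h w → ∃ λ y → y ↑ˡ order H ≡ h w
      step i i≡ with ⊕-view (order G) i
      ... | left y  = y , i≡
      ... | right y = ⊥-elim (subst T (adj-⊕-lr G H x y) (subst₂ (Adj (G ⊕ H)) (sym x≡) (sym i≡) (h-hom u w e)))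

    stays-right : ∀ {u v} → Star (Adj F) u v → (∃ λ x → order G ↑ʳ x ≡ h u) → ∃ λ y → order G ↑ʳ y ≡ h v
    stays-right ε hit = hit
    stays-right {u} (_◅_ {j = w} e es) (x , x≡) = stays-right es (step (h w) refl)
      where
      step : ∀ i → i ≡ h w → ∃ λ y → order G ↑ʳ y ≡ h w
      step i i≡ with ⊕-view (order G) i
      ... | right y = y , i≡
      ... | left y  = ⊥-elim (subst T (adj-⊕-rl G H x y) (subst₂ (Adj (G ⊕ H)) (sym x≡) (sym i≡) (h-hom u w e)))

  inject-surjective : ∀ y → ∃ λ x → inject x G⊕H.≈ y
  inject-surjective (h , h-hom) = split (h root) refl
    where
    split : ∀ i → i ≡ h root → ∃ λ x → inject x G⊕H.≈ (h , h-hom)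
    split i i≡ with ⊕-view (order G) i
    ... | left x  = inj₁ (proj₁ ∘ lift , λ u v e → subst T (adj-⊕-ll G H _ _)
                      (subst₂ (Adj (G ⊕ H)) (sym (proj₂ (lift u))) (sym (proj₂ (lift v))) (h-hom u v e)))
                    , proj₂ ∘ lift
      where
      lift : ∀ v → ∃ λ y → y ↑ˡ order H ≡ h v
      lift v = stays-left h-hom (reach v) (x , i≡)
    ... | right x = inj₂ (proj₁ ∘ lift , λ u v e → subst T (adj-⊕-rr G H _ _)
                      (subst₂ (Adj (G ⊕ H)) (sym (proj₂ (lift u))) (sym (proj₂ (lift v))) (h-hom u v e)))
                    , proj₂ ∘ lift
      where
      lift : ∀ v → ∃ λ y → order G ↑ʳ y ≡ h v
      lift v = stays-right h-hom (reach v) (x , i≡)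

-- Isomorphisms and induced subgraphs.

≅-refl : ∀ {G} → G ≅ G
≅-refl = record { bijection = mk↔ₛ′ id id (λ _ → refl) (λ _ → refl) ; adj-≡ = λ _ _ → refl }

≅-sym : ∀ {G H} → G ≅ H → H ≅ G
≅-sym {G} {H} G≅H = record
  { bijection = ≃-sym bijection
  ; adj-≡     = λ u v → trans (sym (cong₂ (adj H) (strictlyInverseˡ u) (strictlyInverseˡ v))) (sym (adj-≡ (from u) (from v)))
  }
  where open _≅_ G≅H; open Inverse bijection

≅-order : ∀ {G H} → G ≅ H → order G ≡ order H
≅-order G≅H = ↔⇒≡ (_≅_.bijection G≅H)

bijective⇒≅ : ∀ G H (f : Vertex G → Vertex H) → Injective _≡_ _≡_ f → (∀ y → ∃ λ x → f x ≡ y) →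
  (∀ u v → adj G u v ≡ adj H (f u) (f v)) → G ≅ H
bijective⇒≅ G H f f-inj f-surj f-adj = record
  { bijection = mk↔ₛ′ f (proj₁ ∘ f-surj) (proj₂ ∘ f-surj) (λ x → f-inj (proj₂ (f-surj (f x))))
  ; adj-≡     = f-adj
  }

hom-≅ : ∀ {F F′} → F ≅ F′ → ∀ G → hom F G ≡ hom F′ G
hom-≅ {F} {F′} F≅F′ G = #-≃ (isHom? F G) (isHom? F′ G) (isHom-resp F G) (isHom-resp F′ G)
  (bijective⇒≃ (Hom F G) (Hom F′ G)
    (λ (h , h-hom) → h ∘ from , λ u v e → h-hom (from u) (from v) (subst T (_≅_.adj-≡ (≅-sym F≅F′) u v) e))
    (λ eq → eq ∘ from)
    (λ {(h , _)} {(k , _)} eq u → trans (cong h (sym (strictlyInverseʳ u))) (trans (eq (to u)) (cong k (strictlyInverseʳ u))))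
    (λ (h , h-hom) → (h ∘ to , λ u v e → h-hom (to u) (to v) (subst T (adj-≡ u v) e)) , λ u → cong h (strictlyInverseˡ u)))
  where open _≅_ F≅F′; open Inverse bijection

hom-positive : ∀ {F G f} → IsHom F G f → 0 < hom F G
hom-positive {F} {G} {f} f-hom = #-positive (isHom? F G) (isHom-resp F G) (f , f-hom)

record InducedSubgraph (A : SimpleGraph) (P : Pred (Vertex A) 0ℓ) : Set where
  field
    graph     : SimpleGraph
    embed     : Vertex graph → Vertex A
    injective : Injective _≡_ _≡_ embed
    member    : ∀ u → P (embed u)
    covers    : ∀ {v} → P v → ∃ λ u → embed u ≡ v
    induced   : ∀ u v → adj graph u v ≡ adj A (embed u) (embed v)

-- The bijection from `count-tabulate` numbers the vertices satisfying `P`; one such vertex must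
-- exist because graphs are non-empty.
inducedSubgraph : ∀ A {P : Pred (Vertex A) 0ℓ} → Decidable P → ∃ P → InducedSubgraph A P
inducedSubgraph A {P} P? nonempty = build _ (count-tabulate P? id)
  where
  build : ∀ k → Sub ⟦ order A ⟧ P ≃ ⟦ k ⟧ → InducedSubgraph A P
  build zero    e with () ← Inverse.to e nonempty
  build (suc k) e = record
    { graph = record
      { pred-order = k
      ; adj        = λ i j → adj A (embed i) (embed j)
      ; adj-sym    = λ i j → adj-sym A (embed i) (embed j)
      ; no-loop    = λ i → no-loop A (embed i)
      }
    ; embed     = embed
    ; injective = λ {i} {j} eq → trans (sym (strictlyInverseˡ i)) (trans (to-cong eq) (strictlyInverseˡ j))
    ; member    = proj₂ ∘ from
    ; covers    = λ {v} Pv → to (v , Pv) , strictlyInverseʳ (v , Pv)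
    ; induced   = λ _ _ → refl
    }
    where
    open Inverse e
    embed : Fin (suc k) → Vertex A
    embed = proj₁ ∘ from

-- Injective self-maps of finite sets.

module _ {X : Set} {N} (index : X → Fin N) (index-injective : Injective _≡_ _≡_ index)
         (σ : X → X) (σ-injective : Injective _≡_ _≡_ σ) where

  -- Among the first N + 1 points of the orbit of `x` two coincide; injectivity strips their common
  -- number of applications of `σ` until one of them is `x`.
  periodic : ∀ x → ∃ λ k → fold x σ (suc k) ≡ x
  periodic x with i , j , i<j , eq ← pigeonhole (ℕ.n<1+n N) (index ∘ fold x σ ∘ toℕ) =
    cancel _ _ i<j (index-injective eq)
    where
    cancel : ∀ i j → i < j → fold x σ i ≡ fold x σ j → ∃ λ k → fold x σ (suc k) ≡ x
    cancel zero    (suc j) _   eq = j , sym eq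
    cancel (suc i) (suc j) i<j eq = cancel i j (s<s⁻¹ i<j) (σ-injective eq)

  injective⇒surjective : ∀ x → ∃ λ y → σ y ≡ x
  injective⇒surjective x = let k , eq = periodic x in fold x σ k , eq

  -- Going forward from `σ x` along the periodic orbit preserves `P` and eventually arrives at `x`.
  reflects : {P : Pred X 0ℓ} → (∀ {x} → P x → P (σ x)) → ∀ {x} → P (σ x) → P x
  reflects {P} step {x} Pσx = let k , eq = periodic x in
    subst P (trans (fold-σ k) eq) (climb k)
    where
    fold-σ : ∀ k → fold (σ x) σ k ≡ fold x σ (suc k)
    fold-σ zero    = refl
    fold-σ (suc k) = cong σ (fold-σ k)
    climb : ∀ k → P (fold (σ x) σ k)
    climb zero    = Pσx
    climb (suc k) = step (climb k)

-- A section `s` of `σ` is injective, hence surjective by finiteness, and so a two-sided inverse.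
surjective⇒injective : ∀ {n} (σ : Fin n → Fin n) → (∀ y → ∃ λ x → σ x ≡ y) → Injective _≡_ _≡_ σ
surjective⇒injective {n} σ surj {x} {x′} eq =
  trans (sym (s∘σ x)) (trans (cong s eq) (s∘σ x′))
  where
  s : Fin n → Fin n
  s = proj₁ ∘ surj
  σ∘s : ∀ y → σ (s y) ≡ y
  σ∘s = proj₂ ∘ surj
  s-surjective : ∀ x → ∃ λ y → s y ≡ x
  s-surjective = injective⇒surjective id id s
    (λ {y} {y′} eq → trans (sym (σ∘s y)) (trans (cong σ eq) (σ∘s y′)))
  s∘σ : ∀ x → s (σ x) ≡ x
  s∘σ x = let y , sy≡x = s-surjective x in
    trans (cong s (trans (cong σ (sym sy≡x)) (σ∘s y))) sy≡x

Hits : ∀ {m n} → (Fin m → Fin n) → Pred (Fin n) 0ℓ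
Hits f y = ∃ λ x → f x ≡ y

T-⇔⇒≡ : ∀ {x y} → (T x → T y) → (T y → T x) → x ≡ y
T-⇔⇒≡ {false} {false} _ _ = refl
T-⇔⇒≡ {false} {true}  _ g = ⊥-elim (g _)
T-⇔⇒≡ {true}  {false} f _ = ⊥-elim (f _)
T-⇔⇒≡ {true}  {true}  _ _ = refl

-- The composite g ∘ f permutes the vertices of F, so every pair of vertices lies on a finite
-- orbit; hence a non-edge is never mapped to an edge.
mutuallySurjective⇒≅ : ∀ F F′ {f g} → IsHom F F′ f → (∀ y → Hits f y) → IsHom F′ F g → (∀ y → Hits g y) → F ≅ F′
mutuallySurjective⇒≅ F F′ {f} {g} f-hom f-surj g-hom g-surj =
  bijective⇒≅ F F′ f (σ-injective ∘ cong g) f-surj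
    (λ u v → T-⇔⇒≡ (f-hom u v) (reflects (uncurry combine) pair-index-injective σ² σ²-injective {P = uncurry (Adj F)}
      (λ {(x , y)} → g-hom _ _ ∘ f-hom x y) ∘ g-hom _ _))
  where
  σ : Vertex F → Vertex F
  σ = g ∘ f
  σ-injective : Injective _≡_ _≡_ σ
  σ-injective = surjective⇒injective σ λ z →
    let y , gy≡z = g-surj z ; x , fx≡y = f-surj y in x , trans (cong g fx≡y) gy≡z
  σ² : Vertex F × Vertex F → Vertex F × Vertex F
  σ² (u , v) = σ u , σ v
  σ²-injective : Injective _≡_ _≡_ σ²
  σ²-injective eq = cong₂ _,_ (σ-injective (cong proj₁ eq)) (σ-injective (cong proj₂ eq))
  pair-index-injective : Injective _≡_ _≡_ (uncurry (combine {order F} {order F}))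
  pair-index-injective {u , v} {u′ , v′} eq = let u≡ , v≡ = combine-injective u v u′ v′ eq in cong₂ _,_ u≡ v≡

-- Lovász's theorem by inclusion-exclusion over images.

-- `P` lists vertices that the image must contain and `Q` vertices that it must avoid. With `P` all
-- of `A` and `Q` empty these are the surjective homomorphisms; with `P` empty they are the
-- homomorphisms into `A` minus `Q`.
Prescribed : ∀ F A → (P Q : List (Vertex A)) → Pred (Vertex F → Vertex A) 0ℓ
Prescribed F A P Q f = IsHom F A f × All (Hits f) P × All (¬_ ∘ Hits f) Q

hits? : ∀ {m n} (f : Fin m → Fin n) → Decidable (Hits f)
hits? f y = any? λ x → f x ≟ y

prescribed? : ∀ F A P Q → Decidable (Prescribed F A P Q)
prescribed? F A P Q f = isHom? F A f ×-dec All.all? (hits? f) P ×-dec All.all? (¬? ∘ hits? f) Q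

hits-resp : ∀ {m n} {f g : Fin m → Fin n} → f ≗ g → ∀ {y} → Hits f y → Hits g y
hits-resp f≗g (x , eq) = x , trans (sym (f≗g x)) eq

prescribed-resp : ∀ F A P Q → Prescribed F A P Q Respects _≗_
prescribed-resp F A P Q f≗g (f-hom , hit , miss) =
  isHom-resp F A f≗g f-hom , All.map (hits-resp f≗g) hit , All.map (_∘ hits-resp (sym ∘ f≗g)) miss

prescribed : ∀ F A → (P Q : List (Vertex A)) → ℕ
prescribed F A P Q = # prescribed? F A P Q

prescribed-split : ∀ F A y P Q → prescribed F A P Q ≡ prescribed F A (y ∷ P) Q + prescribed F A P (y ∷ Q)
prescribed-split F A y P Q =
  #-⊎ (prescribed? F A (y ∷ P) Q) (prescribed? F A P (y ∷ Q)) (prescribed? F A P Q)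
      (prescribed-resp F A (y ∷ P) Q) (prescribed-resp F A P (y ∷ Q)) (prescribed-resp F A P Q)
      (bijective⇒≃ (Hit ⊎ₛ Miss) Either forget (λ { (inj₁ eq) → eq ; (inj₂ eq) → eq }) forget-injective forget-surjective)
  where
  Hit Miss Either : Setoid 0ℓ 0ℓ
  Hit    = Maps (prescribed? F A (y ∷ P) Q)
  Miss   = Maps (prescribed? F A P (y ∷ Q))
  Either = Maps (prescribed? F A P Q)
  module Hit⊎Miss = Setoid (Hit ⊎ₛ Miss)
  module Either   = Setoid Either

  forget : Hit⊎Miss.Carrier → Either.Carrier
  forget (inj₁ (f , f-hom , hit , miss)) = f , f-hom , All.tail hit , miss
  forget (inj₂ (f , f-hom , hit , miss)) = f , f-hom , hit , All.tail miss

  forget-injective : Injective Hit⊎Miss._≈_ Either._≈_ forget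
  forget-injective {inj₁ _} {inj₁ _} eq = inj₁ eq
  forget-injective {inj₁ (_ , _ , hit ∷ _ , _)} {inj₂ (_ , _ , _ , miss ∷ _)} eq = ⊥-elim (miss (hits-resp eq hit))
  forget-injective {inj₂ (_ , _ , _ , miss ∷ _)} {inj₁ (_ , _ , hit ∷ _ , _)} eq = ⊥-elim (miss (hits-resp (sym ∘ eq) hit))
  forget-injective {inj₂ _} {inj₂ _} eq = inj₂ eq

  forget-surjective : ∀ f → ∃ λ x → forget x Either.≈ f
  forget-surjective (f , f-hom , hit , miss) with hits? f y
  ... | yes y∈ = inj₁ (f , f-hom , y∈ ∷ hit , miss) , λ _ → refl
  ... | no y∉  = inj₂ (f , f-hom , hit , y∉ ∷ miss) , λ _ → refl

-- The graph `B` is `A` with `Q` deleted. If nothing remains there is no such graph, but then the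
-- count vanishes because `F` has a vertex to be mapped somewhere.
prescribed-avoiding : ∀ A Q → (∃ λ B → ∀ F → prescribed F A [] Q ≡ hom F B) ⊎ (∀ F → prescribed F A [] Q ≡ 0)
prescribed-avoiding A Q with any? (λ v → ¬? (Any.any? (v ≟_) Q))
... | no all∈ = inj₂ λ F → ℕ.n≤0⇒n≡0 (ℕ.≮⇒≥ λ 0<# →
      let f , _ , _ , miss = #-witness (prescribed? F A [] Q) (prescribed-resp F A [] Q) 0<#
      in all∈ (f zero , λ f0∈Q → All.lookup miss f0∈Q (zero , refl)))
... | yes nonempty = inj₁ (graph , λ F →
      #-≃ (prescribed? F A [] Q) (isHom? F graph) (prescribed-resp F A [] Q) (isHom-resp F graph)
          (≃-sym (bijective⇒≃ (Hom F graph) (Maps (prescribed? F A [] Q)) (extend F)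
            (λ eq → cong embed ∘ eq)
            (λ eq → injective ∘ eq)
            (extend-surjective F))))
  where
  open InducedSubgraph (inducedSubgraph A (λ v → ¬? (Any.any? (v ≟_) Q)) nonempty)

  extend : ∀ F → Setoid.Carrier (Hom F graph) → ∃ (Prescribed F A [] Q)
  extend F (f , f-hom) = embed ∘ f , (λ u v → subst T (induced (f u) (f v)) ∘ f-hom u v) , [] ,
    All.tabulate λ {q} q∈Q (x , eq) → member (f x) (subst (_∈ Q) (sym eq) q∈Q)

  extend-surjective : ∀ F g → ∃ λ f → proj₁ (extend F f) ≗ proj₁ g
  extend-surjective F (g , g-hom , _ , miss) = (proj₁ ∘ pre , λ u v e → subst T (sym (induced _ _))
      (subst₂ (Adj A) (sym (proj₂ (pre u))) (sym (proj₂ (pre v))) (g-hom u v e)))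
    , proj₂ ∘ pre
    where
    pre : ∀ u → ∃ λ w → embed w ≡ g u
    pre u = covers λ gu∈Q → All.lookup miss gu∈Q (u , refl)

-- Induction on `P`. By `prescribed-split`, hitting `y` is the difference between no condition on
-- `y` and avoiding `y`, so one of these two counts must already differ; when `P` is exhausted, the
-- counts are plain homomorphism numbers.
distinguish : ∀ F F′ A P Q → prescribed F A P Q ≢ prescribed F′ A P Q → ∃ λ B → hom F B ≢ hom F′ B
distinguish F F′ A [] Q differ with prescribed-avoiding A Q
... | inj₁ (B , eq) = B , λ hom-eq → differ (trans (eq F) (trans hom-eq (sym (eq F′))))
... | inj₂ eq       = ⊥-elim (differ (trans (eq F) (sym (eq F′))))
distinguish F F′ A (y ∷ P) Q differ = decide (prescribed F A P Q ℕ.≟ prescribed F′ A P Q)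
  where
  decide : Dec (prescribed F A P Q ≡ prescribed F′ A P Q) → ∃ λ B → hom F B ≢ hom F′ B
  decide (no differ′) = distinguish F F′ A P Q differ′
  decide (yes eq)     = distinguish F F′ A P (y ∷ Q) λ eq′ →
    differ (ℕ.+-cancelʳ-≡ (prescribed F A P (y ∷ Q)) _ _ (begin
      prescribed F A (y ∷ P) Q + prescribed F A P (y ∷ Q)    ≡⟨ prescribed-split F A y P Q ⟨
      prescribed F A P Q                                     ≡⟨ eq ⟩
      prescribed F′ A P Q                                    ≡⟨ prescribed-split F′ A y P Q ⟩
      prescribed F′ A (y ∷ P) Q + prescribed F′ A P (y ∷ Q)  ≡⟨ cong (_ +_) eq′ ⟨
      prescribed F′ A (y ∷ P) Q + prescribed F A P (y ∷ Q)   ∎))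
    where open ≡-Reasoning

-- The identity makes the left-hand count positive, so the right-hand one has a witness.
surjectiveHom : ∀ F F′ → prescribed F F (List.allFin _) [] ≡ prescribed F′ F (List.allFin _) [] →
  ∃ λ g → IsHom F′ F g × (∀ y → Hits g y)
surjectiveHom F F′ eq =
  let g , g-hom , hit , _ = #-witness (prescribed? F′ F _ []) (prescribed-resp F′ F _ [])
        (subst (0 <_) eq (#-positive (prescribed? F F _ []) (prescribed-resp F F _ [])
          (id , (λ _ _ e → e) , All.tabulate (λ {y} _ → y , refl) , [])))
  in g , g-hom , λ y → All.lookup hit (∈-allFin y)

-- Lovász's theorem.
≅-or-distinguished : ∀ F F′ → F ≅ F′ ⊎ ∃ λ B → hom F B ≢ hom F′ B
≅-or-distinguished F F′ = decide (onto F F ℕ.≟ onto F′ F) (onto F′ F′ ℕ.≟ onto F F′)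
  where
  onto : SimpleGraph → SimpleGraph → ℕ
  onto G A = prescribed G A (List.allFin (order A)) []

  decide : Dec (onto F F ≡ onto F′ F) → Dec (onto F′ F′ ≡ onto F F′) → F ≅ F′ ⊎ ∃ λ B → hom F B ≢ hom F′ B
  decide (no differ) _            = inj₂ (distinguish F F′ F (List.allFin (order F)) [] differ)
  decide (yes _)     (no differ)  =
    inj₂ (let B , ≢B = distinguish F′ F F′ (List.allFin (order F′)) [] differ in B , ≢B ∘ sym)
  decide (yes eq)    (yes eq′)    =
    let g , g-hom , g-surj = surjectiveHom F F′ eq
        f , f-hom , f-surj = surjectiveHom F′ F eq′
    in inj₁ (mutuallySurjective⇒≅ F F′ f-hom f-surj g-hom g-surj)

-- Separating a connected graph from finitely many others.

-- The base graph `H` gives a meaning to zero copies of `G`, as there is no null graph.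
addCopies : ℕ → SimpleGraph → SimpleGraph → SimpleGraph
addCopies zero    G H = H
addCopies (suc n) G H = G ⊕ addCopies n G H

hom-addCopies : ∀ F → Connected F → ∀ n G H → hom F (addCopies n G H) ≡ n * hom F G + hom F H
hom-addCopies F connected zero    G H = refl
hom-addCopies F connected (suc n) G H = begin
  hom F (G ⊕ addCopies n G H)           ≡⟨ hom-⊕-target F connected G (addCopies n G H) ⟩
  hom F G + hom F (addCopies n G H)     ≡⟨ cong (hom F G +_) (hom-addCopies F connected n G H) ⟩
  hom F G + (n * hom F G + hom F H)     ≡⟨ ℕ.+-assoc (hom F G) (n * hom F G) (hom F H) ⟨
  hom F G + n * hom F G + hom F H       ∎
  where open ≡-Reasoning

-- (y − x)(a − c) = 0, with the negative terms moved to the other side.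
swap-cancel-< : ∀ a c x y → x < y → c * y + x * a ≡ c * x + y * a → a ≡ c
swap-cancel-< a c x y x<y eq with d , refl ← ℕ.m≤n⇒∃[o]m+o≡n x<y =
  sym (ℕ.*-cancelˡ-≡ c a (suc d) (ℕ.+-cancelˡ-≡ (c * x + x * a) _ _
    (trans (sym (expandˡ a c x d)) (trans eq (expandʳ a c x d)))))
  where
  expandˡ : ∀ a c x d → c * (suc x + d) + x * a ≡ (c * x + x * a) + suc d * c
  expandˡ = solve-∀
  expandʳ : ∀ a c x d → c * x + (suc x + d) * a ≡ (c * x + x * a) + suc d * a
  expandʳ = solve-∀

swap-cancel : ∀ a c x y → c * y + x * a ≡ c * x + y * a → a ≢ c → x ≡ y
swap-cancel a c x y eq a≢c with ℕ.<-cmp x y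
... | tri≈ _ x≡y _ = x≡y
... | tri< x<y _ _ = ⊥-elim (a≢c (swap-cancel-< a c x y x<y eq))
... | tri> _ _ y<x = ⊥-elim (a≢c (swap-cancel-< a c y x y<x (sym eq)))

-- The pair stands for the formal difference T₊ - T₋. Entries isomorphic to `L` are exempt, since
-- the two graphs cannot agree on them.
Separated : SimpleGraph → List SimpleGraph → Set
Separated L Ds = ∃₂ λ T₊ T₋ → hom L T₊ ≢ hom L T₋ × All (λ D → D ≅ L ⊎ hom D T₊ ≡ hom D T₋) Ds

-- For connected D, hom D (−) is a homomorphism of semirings, so replacing T₊ − T₋ by
-- (T₊ − T₋)(A − c) with c = hom D A makes hom D agree, and keeps hom L apart if hom L A ≠ c.
module _ (T₊ T₋ A D : SimpleGraph) where
  private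
    c : ℕ
    c = hom D A

    -- Expanding, (T₊ - T₋)(A - c) = (c T₋ + T₊ A) - (c T₊ + T₋ A), so `U T₋ T₊` is the new positive
    -- part and `U T₊ T₋` the new negative one.
    U : SimpleGraph → SimpleGraph → SimpleGraph
    U T T′ = addCopies c T (T′ ⊗ A)

    hom-U : ∀ F → Connected F → ∀ T T′ → hom F (U T T′) ≡ c * hom F T + hom F T′ * hom F A
    hom-U F F-conn T T′ = trans (hom-addCopies F F-conn c T (T′ ⊗ A)) (cong (c * hom F T +_) (hom-⊗ F T′ A))

    differ-U : ∀ L → Connected L → hom L T₊ ≢ hom L T₋ → c ≢ hom L A → hom L (U T₋ T₊) ≢ hom L (U T₊ T₋)
    differ-U L L-conn differ c≢ eq = differ (swap-cancel (hom L A) c (hom L T₊) (hom L T₋)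
      (trans (sym (hom-U L L-conn T₋ T₊)) (trans eq (hom-U L L-conn T₊ T₋))) (c≢ ∘ sym))

    agree-D : Connected D → hom D (U T₋ T₊) ≡ hom D (U T₊ T₋)
    agree-D D-conn = trans (hom-U D D-conn T₋ T₊)
      (trans (transpose c (hom D T₊) (hom D T₋)) (sym (hom-U D D-conn T₊ T₋)))
      where
      transpose : ∀ c x y → c * y + x * c ≡ c * x + y * c
      transpose = solve-∀

    agree-U : ∀ L F → Connected F → F ≅ L ⊎ hom F T₊ ≡ hom F T₋ → F ≅ L ⊎ hom F (U T₋ T₊) ≡ hom F (U T₊ T₋)
    agree-U L F F-conn (inj₁ F≅L) = inj₁ F≅L
    agree-U L F F-conn (inj₂ eq)  = inj₂ (trans (hom-U F F-conn T₋ T₊)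
      (trans (cong₂ (λ s t → c * s + t * hom F A) (sym eq) eq) (sym (hom-U F F-conn T₊ T₋))))

  separate-∷ : ∀ L {Ds} → Connected L → Connected D → All Connected Ds → c ≢ hom L A → hom L T₊ ≢ hom L T₋ →
    All (λ F → F ≅ L ⊎ hom F T₊ ≡ hom F T₋) Ds → Separated L (D ∷ Ds)
  separate-∷ L L-conn D-conn Ds-conn c≢ differ agree = U T₋ T₊ , U T₊ T₋ , differ-U L L-conn differ c≢ ,
    inj₂ (agree-D D-conn) ∷ All.zipWith (λ {F} (F-conn , ≅⊎≡) → agree-U L F F-conn ≅⊎≡) (Ds-conn , agree)

-- Induction on the list: Lovász's theorem supplies a factor for each entry not isomorphic to `L`,
-- and the other entries are skipped.
separate : ∀ L → Connected L → ∀ {Ds} → All Connected Ds → Separated L Ds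
-- The starting difference represents `L` itself, on which `hom L` is positive by the identity.
separate L L-conn [] = L ⊕ L , L , differ , []
  where
  differ : hom L (L ⊕ L) ≢ hom L L
  differ eq = ℕ.<⇒≢ (ℕ.m<m+n (hom L L) (hom-positive {L} {L} {id} (λ _ _ e → e)))
    (trans (sym eq) (hom-⊕-target L L-conn L L))
separate L L-conn {D ∷ Ds} (D-conn ∷ Ds-conn) = extend (separate L L-conn Ds-conn) (≅-or-distinguished D L)
  where
  extend : Separated L Ds → D ≅ L ⊎ (∃ λ A → hom D A ≢ hom L A) → Separated L (D ∷ Ds)
  extend (T₊ , T₋ , differ , agree) (inj₁ D≅L)       = T₊ , T₋ , differ , inj₁ D≅L ∷ agree
  extend (T₊ , T₋ , differ , agree) (inj₂ (A , D≢L)) = separate-∷ T₊ T₋ A D L L-conn D-conn Ds-conn D≢L differ agree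

-- Components and decompositions into components.

-- The image is a union of components. Connectedness is not asked for, so that the notion also
-- covers what remains after a component is split off.
record ClosedEmbedding (C F : SimpleGraph) : Set where
  field
    embed     : Vertex C → Vertex F
    injective : Injective _≡_ _≡_ embed
    induced   : ∀ u v → adj C u v ≡ adj F (embed u) (embed v)
    closed    : ∀ u {w} → Adj F (embed u) w → ∃ λ v → embed v ≡ w

  push : ∀ {u v} → Star (Adj C) u v → Star (Adj F) (embed u) (embed v)
  push = gmap embed (subst T (induced _ _))

  pull : ∀ {u w} → Star (Adj F) (embed u) w → ∃ λ v → embed v ≡ w × Star (Adj C) u v
  pull es = go es refl
    where
    -- The start is a variable `x` with an equation, so that the walk can be taken apart by
    -- matching.
    go : ∀ {u x w} → Star (Adj F) x w → embed u ≡ x → ∃ λ v → embed v ≡ w × Star (Adj C) u v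
    go {u} ε        refl = u , refl , ε
    go {u} (e ◅ es) refl with v , refl ← closed u e with w , eq , path ← go {v} es refl =
      w , eq , subst T (sym (induced u v)) e ◅ path

component⇒closed : ∀ {C F} → IsComponentOf C F → ClosedEmbedding C F
component⇒closed C⊑F = record
  { embed     = embed
  ; injective = injective
  ; induced   = induced
  ; closed    = λ u e → Equivalence.to (image _) (Equivalence.from (image _) (u , refl) ◅◅ e ◅ ε)
  }
  where open IsComponentOf C⊑F

component-connected : ∀ {C F} → IsComponentOf C F → Connected C
component-connected {C} {F} C⊑F = root′ , reach
  where
  open IsComponentOf C⊑F
  root′ : Vertex C
  root′ = proj₁ (Equivalence.to (image root) ε)
  reach : ∀ v → Star (Adj C) root′ v
  reach v with v′ , eq , path ← ClosedEmbedding.pull (component⇒closed C⊑F)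
                 (subst (λ x → Star (Adj F) x (embed v)) (sym (proj₂ (Equivalence.to (image root) ε)))
                   (Equivalence.from (image (embed v)) (v , refl)))
          with refl ← injective eq = path

-- A walk of `F` that starts in `R` never leaves `R`, so reachability is the same in both graphs.
component-∘ : ∀ {D R F} → ClosedEmbedding R F → IsComponentOf D R → IsComponentOf D F
component-∘ R⊆F D⊑R = record
  { root      = R.embed D.root
  ; embed     = R.embed ∘ D.embed
  ; injective = D.injective ∘ R.injective
  ; induced   = λ u v → trans (D.induced u v) (R.induced _ _)
  ; image     = λ w → mk⇔
      (λ path → let v , v≡ , path′ = R.pull path ; u , u≡ = Equivalence.to (D.image v) path′
                in u , trans (cong R.embed u≡) v≡)
      (λ { (u , refl) → R.push (Equivalence.from (D.image _) (u , refl)) })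
  }
  where
  module R = ClosedEmbedding R⊆F
  module D = IsComponentOf D⊑R

-- The remainder is induced on the vertices outside the image. The first case is that of an empty
-- remainder, which is not a graph here.
splitOff : ∀ {C F} → ClosedEmbedding C F → F ≅ C ⊎ ∃ λ R → F ≅ C ⊕ R × ClosedEmbedding R F
splitOff {C} {F} C⊆F with any? (λ w → ¬? (hits? (ClosedEmbedding.embed C⊆F) w))
... | no all = inj₁ (≅-sym (bijective⇒≅ C F embed injective
                 (λ w → decidable-stable (hits? embed w) (λ w∉ → all (w , w∉))) induced))
  where open ClosedEmbedding C⊆F
... | yes nonempty = inj₂ (R.graph
  , ≅-sym (bijective⇒≅ (C ⊕ R.graph) F f f-injective f-surjective f-adj)
  , record
    { embed     = R.embed
    ; injective = R.injective
    ; induced   = R.induced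
    -- An edge from the remainder into the image, read backwards, would put its start into the image
    -- as well.
    ; closed    = λ u {w} e → R.covers λ { (v , refl) →
        R.member u (closed v (subst T (adj-sym F (R.embed u) w) e)) }
    })
  where
  open ClosedEmbedding C⊆F
  module R = InducedSubgraph (inducedSubgraph F (λ w → ¬? (hits? embed w)) nonempty)

  f : Vertex (C ⊕ R.graph) → Vertex F
  f = copair embed R.embed

  f-↑ˡ : ∀ u → f (u ↑ˡ order R.graph) ≡ embed u
  f-↑ˡ = copair-↑ˡ embed R.embed

  f-↑ʳ : ∀ v → f (order C ↑ʳ v) ≡ R.embed v
  f-↑ʳ = copair-↑ʳ embed R.embed

  f-injective : Injective _≡_ _≡_ f
  f-injective {i} {j} eq with ⊕-view (order C) i | ⊕-view (order C) j
  ... | left u  | left v  = cong (_↑ˡ order R.graph) (injective (trans (sym (f-↑ˡ u)) (trans eq (f-↑ˡ v))))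
  ... | left u  | right v = ⊥-elim (R.member v (u , trans (sym (f-↑ˡ u)) (trans eq (f-↑ʳ v))))
  ... | right u | left v  = ⊥-elim (R.member u (v , trans (sym (f-↑ˡ v)) (trans (sym eq) (f-↑ʳ u))))
  ... | right u | right v = cong (order C ↑ʳ_) (R.injective (trans (sym (f-↑ʳ u)) (trans eq (f-↑ʳ v))))

  f-surjective : ∀ w → Hits f w
  f-surjective w with hits? embed w
  ... | yes (u , eq) = u ↑ˡ order R.graph , trans (f-↑ˡ u) eq
  ... | no w∉ with v , eq ← R.covers w∉ = order C ↑ʳ v , trans (f-↑ʳ v) eq

  no-cross : ∀ u v → adj F (embed u) (R.embed v) ≡ false
  no-cross u v = T-⇔⇒≡ (R.member v ∘ closed u) (λ ())

  f-adj : ∀ i j → adj (C ⊕ R.graph) i j ≡ adj F (f i) (f j)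
  f-adj i j with ⊕-view (order C) i | ⊕-view (order C) j
  ... | left u  | left v  = trans (adj-⊕-ll C R.graph u v) (trans (induced u v)
                              (sym (cong₂ (adj F) (f-↑ˡ u) (f-↑ˡ v))))
  ... | left u  | right v = trans (adj-⊕-lr C R.graph u v) (trans (sym (no-cross u v))
                              (sym (cong₂ (adj F) (f-↑ˡ u) (f-↑ʳ v))))
  ... | right u | left v  = trans (adj-⊕-rl C R.graph u v) (trans (sym (trans (adj-sym F _ _) (no-cross v u)))
                              (sym (cong₂ (adj F) (f-↑ʳ u) (f-↑ˡ v))))
  ... | right u | right v = trans (adj-⊕-rr C R.graph u v) (trans (R.induced u v)
                              (sym (cong₂ (adj F) (f-↑ʳ u) (f-↑ʳ v))))

-- Makes reachability decidable, as `inducedSubgraph` demands: the set grows by one neighbour at a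
-- time until no edge leaves it, which terminates because strict supersets are well-founded.
reachable : ∀ F root → ∃ λ (S : Subset (order F)) → ∀ w → Star (Adj F) root w ⇔ w ∈ₛ S
reachable F root = grow ⁅ root ⁆ (⊃-wellFounded _) (x∈⁅x⁆ root)
  λ w∈ → subst (Star (Adj F) root) (sym (x∈⁅y⁆⇒x≡y root w∈)) ε
  where
  grow : ∀ S → Acc _⊃_ S → root ∈ₛ S → (∀ {w} → w ∈ₛ S → Star (Adj F) root w) →
    ∃ λ (S : Subset (order F)) → ∀ w → Star (Adj F) root w ⇔ w ∈ₛ S
  grow S (acc larger) root∈S sound
    with any? (λ u → any? (λ v → (u ∈ₛ? S) ×-dec T? (adj F u v) ×-dec ¬? (v ∈ₛ? S)))
  ... | yes (u , v , u∈S , e , v∉S) =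
    grow (S ∪ ⁅ v ⁆) (larger (p⊆p∪q ⁅ v ⁆ , v , x∈p∪q⁺ (inj₂ (x∈⁅x⁆ v)) , v∉S)) (x∈p∪q⁺ (inj₁ root∈S))
      λ w∈ → [ sound , (λ w∈⁅v⁆ → subst (Star (Adj F) root) (sym (x∈⁅y⁆⇒x≡y v w∈⁅v⁆)) (sound u∈S ◅◅ e ◅ ε)) ]′
               (x∈p∪q⁻ S ⁅ v ⁆ w∈)
  ... | no closed = S , λ w → mk⇔ (stay root∈S) sound
    where
    stay : ∀ {u w} → u ∈ₛ S → Star (Adj F) u w → w ∈ₛ S
    stay u∈S ε        = u∈S
    stay u∈S (_◅_ {j = v} e es) = stay (decidable-stable (v ∈ₛ? S) λ v∉S → closed (_ , v , u∈S , e , v∉S)) es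

component : ∀ F → Vertex F → ∃ λ C → IsComponentOf C F
component F root with S , S-spec ← reachable F root = graph , record
  { root      = root
  ; embed     = embed
  ; injective = injective
  ; induced   = induced
  ; image     = λ w → mk⇔ (covers ∘ Equivalence.to (S-spec w))
                          (λ { (u , refl) → Equivalence.from (S-spec w) (member u) })
  }
  where open InducedSubgraph (inducedSubgraph F (_∈ₛ? S) (root , Equivalence.to (S-spec root) ε))

-- The base case is a single component, as there is no empty graph. The closed embedding of `R` is
-- kept to turn components of `R` into components of `F`.
data Decomposition (F : SimpleGraph) : List SimpleGraph → Set where
  connected : ∀ {C} → IsComponentOf C F → F ≅ C → Decomposition F (C ∷ [])
  summand   : ∀ {C R Ds} → IsComponentOf C F → F ≅ C ⊕ R → ClosedEmbedding R F → Decomposition R Ds →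
              Decomposition F (C ∷ Ds)

decompose : ∀ F → ∃ (Decomposition F)
decompose F = go F (<-wellFounded (order F))
  where
  go : ∀ F → Acc _<_ (order F) → ∃ (Decomposition F)
  go F (acc smaller) with component F zero
  ... | C , C⊑F with splitOff (component⇒closed C⊑F)
  ...   | inj₁ F≅C               = C ∷ [] , connected C⊑F F≅C
  ...   | inj₂ (R , F≅C⊕R , R⊆F) =
    -- `C` has at least one vertex, so `R` is strictly smaller than `F`.
    let Ds , dec = go R (smaller (subst (order R <_) (sym (≅-order F≅C⊕R)) (s≤s (ℕ.m≤n+m (order R) (pred-order C)))))
    in C ∷ Ds , summand C⊑F F≅C⊕R R⊆F dec

decomposition-components : ∀ {F Ds} → Decomposition F Ds → All (λ D → IsComponentOf D F) Ds
decomposition-components (connected C⊑F _)         = C⊑F ∷ []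
decomposition-components (summand C⊑F _ R⊆F dec) = C⊑F ∷ All.map (component-∘ R⊆F) (decomposition-components dec)

hom-decomposition : ∀ {F Ds} → Decomposition F Ds → ∀ G → hom F G ≡ product (List.map (λ D → hom D G) Ds)
hom-decomposition (connected {C} _ F≅C) G = trans (hom-≅ F≅C G) (sym (ℕ.*-identityʳ (hom C G)))
hom-decomposition (summand {C} {R} _ F≅C⊕R _ dec) G =
  trans (hom-≅ F≅C⊕R G) (trans (hom-⊕-source C R G) (cong (hom C G *_) (hom-decomposition dec G)))

-- Comparing products over components.

-- Positivity of the smaller factors keeps a zero elsewhere from swallowing the strict increase.
product-< : ∀ {A : Set} (f g : A → ℕ) {xs} → All (λ x → 0 < f x × f x ≤ g x) xs → Any (λ x → f x < g x) xs →
  product (List.map f xs) < product (List.map g xs)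
product-< f g {x ∷ xs} ((0<fx , _) ∷ all) (here fx<gx) =
  ℕ.<-≤-trans (ℕ.*-monoˡ-< pf {{>-nonZero (positive all)}} fx<gx) (ℕ.*-monoʳ-≤ (g x) (monotone all))
  where
  pf = product (List.map f xs)
  positive : ∀ {ys} → All (λ y → 0 < f y × f y ≤ g y) ys → 0 < product (List.map f ys)
  positive []                  = z<s
  positive ((0<fy , _) ∷ rest) = ℕ.*-mono-< 0<fy (positive rest)
  monotone : ∀ {ys} → All (λ y → 0 < f y × f y ≤ g y) ys → product (List.map f ys) ≤ product (List.map g ys)
  monotone []                    = ℕ.≤-refl
  monotone ((_ , fy≤gy) ∷ rest) = ℕ.*-mono-≤ fy≤gy (monotone rest)
product-< f g {x ∷ xs} ((0<fx , fx≤gx) ∷ all) (there any) =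
  ℕ.<-≤-trans (ℕ.*-monoʳ-< (f x) {{>-nonZero 0<fx}} (product-< f g all any)) (ℕ.*-monoˡ-≤ _ fx≤gx)

≢⇒<⊎> : m ≢ n → m < n ⊎ n < m
≢⇒<⊎> {m} {n} m≢n with ℕ.<-cmp m n
... | tri< m<n _ _ = inj₁ m<n
... | tri≈ _ m≡n _ = ⊥-elim (m≢n m≡n)
... | tri> _ _ n<m = inj₂ n<m

any-or-all : ∀ {A : Set} {P Q : Pred A 0ℓ} {xs} → All (λ x → P x ⊎ Q x) xs → Any P xs ⊎ All Q xs
any-or-all []             = inj₂ []
any-or-all (inj₁ Px ∷ _)  = inj₁ (here Px)
any-or-all (inj₂ Qx ∷ pq) = Sum.map there (Qx ∷_) (any-or-all pq)

component-positive : ∀ {C F} → IsComponentOf C F → 0 < hom C F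
component-positive {C} {F} C⊑F = hom-positive {C} {F} {embed} (λ u v → subst T (induced u v))
  where open IsComponentOf C⊑F

hom-≡-components : ∀ G H {F Ds} → Decomposition F Ds → All (λ D → hom D G ≡ hom D H) Ds → hom F G ≡ hom F H
hom-≡-components G H dec eqs = trans (hom-decomposition dec G)
  (trans (cong product (map-cong-local eqs)) (sym (hom-decomposition dec H)))

-- Membership in the class through components.

module _ {𝓕 : Pred SimpleGraph ℓ} (resp : 𝓕 Respects _≅_) where

  component∈ : ClosedUnderSummands 𝓕 → ∀ {C F} → IsComponentOf C F → 𝓕 F → 𝓕 C
  component∈ summands C⊑F F∈𝓕 with splitOff (component⇒closed C⊑F)
  ... | inj₁ F≅C             = resp F≅C F∈𝓕
  ... | inj₂ (_ , F≅C⊕R , _) = proj₁ (summands _ _ (resp F≅C⊕R F∈𝓕))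

  compose∈ : ClosedUnderDisjointUnions 𝓕 → ∀ {F Ds} → Decomposition F Ds → All 𝓕 Ds → 𝓕 F
  compose∈ unions (connected _ F≅C)         (C∈𝓕 ∷ [])   = resp (≅-sym F≅C) C∈𝓕
  compose∈ unions (summand _ F≅C⊕R _ dec) (C∈𝓕 ∷ Ds∈𝓕) =
    resp (≅-sym F≅C⊕R) (unions _ _ C∈𝓕 (compose∈ unions dec Ds∈𝓕))

-- Components of a graph in the closure.

module _ (𝓕 : Pred SimpleGraph ℓ) (K : SimpleGraph) (finite : EssentiallyFinite (𝓕 mappingTo K)) where
  private
    Cs : List SimpleGraph
    Cs = proj₁ finite

    Cs-spec : ∀ C → Γ (𝓕 mappingTo K) C ⇔ Any (C ≅_) Cs
    Cs-spec = proj₂ finite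

    Cs-connected : All Connected Cs
    Cs-connected = All.tabulate λ C∈Cs →
      -- An entry of `Cs` is isomorphic to itself, so it is a component of some graph in the class.
      let _ , _ , C⊑F = Equivalence.from (Cs-spec _) (Any.map (λ { refl → ≅-refl }) C∈Cs)
      in component-connected C⊑F

  -- Multiplying the targets by K equalises all F ∈ 𝓕 with hom F K = 0.
  agree-on-𝓕 : ∀ G H → All (λ C → hom C G ≡ hom C H) Cs → (G ⊗ K) ≡[ 𝓕 ] (H ⊗ K)
  agree-on-𝓕 G H agree F F∈𝓕 = trans (hom-⊗ F G K)
    (trans (scale (hom F G) (hom F H) (hom F K) agree-on-F) (sym (hom-⊗ F H K)))
    where
    scale : ∀ x y k → (0 < k → x ≡ y) → x * k ≡ y * k
    scale x y zero    _  = trans (ℕ.*-zeroʳ x) (sym (ℕ.*-zeroʳ y))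
    scale x y (suc k) eq = cong (_* suc k) (eq z<s)

    agree-on-component : 0 < hom F K → ∀ {D} → IsComponentOf D F → hom D G ≡ hom D H
    agree-on-component 0<homFK {D} D⊑F =
      let C , C∈Cs , D≅C = find (Equivalence.to (Cs-spec D) (F , (F∈𝓕 , 0<homFK) , D⊑F))
      in trans (hom-≅ D≅C G) (trans (All.lookup agree C∈Cs) (sym (hom-≅ D≅C H)))

    agree-on-F : 0 < hom F K → hom F G ≡ hom F H
    agree-on-F 0<homFK = by-components (decompose F)
      where
      by-components : ∃ (Decomposition F) → hom F G ≡ hom F H
      by-components (_ , dec) = hom-≡-components G H dec (All.map (agree-on-component 0<homFK) (decomposition-components dec))

  module _ (K∈cl : cl 𝓕 K) {Ls} (dec : Decomposition K Ls) {L} (L∈Ls : L ∈ Ls) where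
    private
      components : All (λ D → IsComponentOf D K) Ls
      components = decomposition-components dec

      Ls-connected : All Connected Ls
      Ls-connected = All.map component-connected components

      L-connected : Connected L
      L-connected = All.lookup Ls-connected L∈Ls

      -- `L` may occur several times among the components of `K`; all its copies change in the same
      -- direction, so no cancellation can occur in the product.
      strict : ∀ G H → (∀ {D} → IsComponentOf D K → 0 < hom D G) →
        All (λ D → D ≅ L ⊎ hom D G ≡ hom D H) Ls → hom L G < hom L H → hom K G < hom K H
      strict G H positive eqs L< = subst₂ _<_ (sym (hom-decomposition dec G)) (sym (hom-decomposition dec H))
        (product-< (λ D → hom D G) (λ D → hom D H)
          (All.zipWith (λ {D} (D⊑K , ≅⊎≡) → positive D⊑K , monotone D ≅⊎≡) (components , eqs))
          (Any.map (λ { refl → L< }) L∈Ls))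
        where
        monotone : ∀ D → D ≅ L ⊎ hom D G ≡ hom D H → hom D G ≤ hom D H
        monotone D (inj₁ D≅L) = ℕ.<⇒≤ (subst₂ _<_ (sym (hom-≅ D≅L G)) (sym (hom-≅ D≅L H)) L<)
        monotone D (inj₂ eq)  = ℕ.≤-reflexive eq

      K-differs : ∀ G H → (∀ {D} → IsComponentOf D K → 0 < hom D G) → (∀ {D} → IsComponentOf D K → 0 < hom D H) →
        All (λ D → D ≅ L ⊎ hom D G ≡ hom D H) Ls → hom L G ≢ hom L H → hom K G ≢ hom K H
      K-differs G H G-pos H-pos agree differ eq = [ (λ L< → ℕ.<⇒≢ (strict G H G-pos agree L<) eq)
        , (λ L> → ℕ.<⇒≢ (strict H G H-pos (All.map (Sum.map₂ sym) agree) L>) (sym eq)) ]′ (≢⇒<⊎> differ)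

      -- Membership of `K` in the closure forces equal counts into the two graphs `(T₊ ⊕ K) ⊗ K` and
      -- `(T₋ ⊕ K) ⊗ K`, while `K-differs` shows that they are unequal before multiplication by `K`.
      refute : ∀ T₊ T₋ → hom L T₊ ≢ hom L T₋ → All (λ C → hom C T₊ ≡ hom C T₋) Cs →
        ¬ All (λ D → D ≅ L ⊎ hom D T₊ ≡ hom D T₋) Ls
      refute T₊ T₋ differ agree-Cs agree-Ls = K-differs (T₊ ⊕ K) (T₋ ⊕ K) (positive T₊) (positive T₋)
        (All.zipWith (λ {D} (D-conn , ≅⊎≡) → Sum.map₂ (add-K D D-conn) ≅⊎≡) (Ls-connected , agree-Ls))
        (λ eq → differ (ℕ.+-cancelʳ-≡ (hom L K) (hom L T₊) (hom L T₋)
          (trans (sym (hom-⊕-target L L-connected T₊ K)) (trans eq (hom-⊕-target L L-connected T₋ K)))))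
        -- The factor `hom K K` can be cancelled, being positive by the identity.
        (ℕ.*-cancelʳ-≡ (hom K (T₊ ⊕ K)) (hom K (T₋ ⊕ K)) (hom K K)
          {{>-nonZero (hom-positive {K} {K} {id} (λ _ _ e → e))}}
          (trans (sym (hom-⊗ K (T₊ ⊕ K) K))
            (trans (K∈cl ((T₊ ⊕ K) ⊗ K) ((T₋ ⊕ K) ⊗ K) agree-on-𝓕′) (hom-⊗ K (T₋ ⊕ K) K))))
        where
        add-K : ∀ D → Connected D → hom D T₊ ≡ hom D T₋ → hom D (T₊ ⊕ K) ≡ hom D (T₋ ⊕ K)
        add-K D D-conn eq = trans (hom-⊕-target D D-conn T₊ K)
          (trans (cong (_+ hom D K) eq) (sym (hom-⊕-target D D-conn T₋ K)))

        positive : ∀ T {D} → IsComponentOf D K → 0 < hom D (T ⊕ K)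
        positive T {D} D⊑K = subst (0 <_) (sym (hom-⊕-target D (component-connected D⊑K) T K))
          (ℕ.<-≤-trans (component-positive D⊑K) (ℕ.m≤n+m (hom D K) (hom D T)))

        agree-on-𝓕′ : ((T₊ ⊕ K) ⊗ K) ≡[ 𝓕 ] ((T₋ ⊕ K) ⊗ K)
        agree-on-𝓕′ = agree-on-𝓕 (T₊ ⊕ K) (T₋ ⊕ K)
          (All.zipWith (λ {C} (C-conn , eq) → add-K C C-conn eq) (Cs-connected , agree-Cs))

    -- `L` is separated from `Cs` and `Ls` at once. Either some entry of `Cs` is isomorphic to `L`,
    -- which is the claim, or the agreement on `Cs` has no exception and `refute` applies.
    cl-component : Γ (𝓕 mappingTo K) L
    cl-component = decide (separate L L-connected (All.++⁺ Cs-connected Ls-connected))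
      where
      decide : Separated L (Cs List.++ Ls) → Γ (𝓕 mappingTo K) L
      decide (T₊ , T₋ , differ , agree) =
        [ (λ L∈Cs → Equivalence.from (Cs-spec L) (Any.map ≅-sym L∈Cs))
        , (λ agree-Cs → ⊥-elim (refute T₊ T₋ differ agree-Cs (All.++⁻ʳ Cs agree))) ]′
        (any-or-all (All.++⁻ˡ Cs agree))

-- The two closure theorems.

summandClosed⇒homDistinguishingClosed : (𝓕 : Pred SimpleGraph ℓ) → 𝓕 Respects _≅_ →
  EssentiallyProfinite 𝓕 → ClosedUnderDisjointUnions 𝓕 → ClosedUnderSummands 𝓕 → HomDistinguishingClosed 𝓕
summandClosed⇒homDistinguishingClosed 𝓕 resp profinite unions summands =
    (λ {K} K∈cl → cl⊆𝓕 K K∈cl (decompose K))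
  , λ K∈𝓕 _ _ G≡H → G≡H _ K∈𝓕
  where
  Γ⊆𝓕 : ∀ K L → Γ (𝓕 mappingTo K) L → 𝓕 L
  Γ⊆𝓕 _ _ (_ , (F∈𝓕 , _) , L⊑F) = component∈ resp summands L⊑F F∈𝓕

  cl⊆𝓕 : ∀ K → cl 𝓕 K → ∃ (Decomposition K) → 𝓕 K
  cl⊆𝓕 K K∈cl (_ , dec) = compose∈ resp unions dec
    -- Profiniteness is applied to the very graph `K` whose membership is to be shown.
    (All.tabulate λ {L} L∈Ls → Γ⊆𝓕 K L (cl-component 𝓕 K (profinite K) K∈cl dec L∈Ls))

-- A summand is a subgraph, hence a minor obtained by an empty sequence of contractions.
minorClosed⇒summandClosed : (𝓕 : Pred SimpleGraph ℓ) → ClosedUnderMinors 𝓕 → ClosedUnderSummands 𝓕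
minorClosed⇒summandClosed 𝓕 minors F₁ F₂ F₁⊕F₂∈𝓕 =
    minors F₁ (F₁ ⊕ F₂) (F₁ ⊕ F₂ , ε , record
      { embed = _↑ˡ order F₂ ; injective = ↑ˡ-injective (order F₂) _ _ ; isHom = isHom-inˡ F₁ F₂ }) F₁⊕F₂∈𝓕
  , minors F₂ (F₁ ⊕ F₂) (F₁ ⊕ F₂ , ε , record
      { embed = order F₁ ↑ʳ_ ; injective = ↑ʳ-injective (order F₁) _ _ ; isHom = isHom-inʳ F₁ F₂ }) F₁⊕F₂∈𝓕

theorem3 : ∀ {ℓ} →
    ((𝓕 : Pred SimpleGraph ℓ) → 𝓕 Respects _≅_ →
    EssentiallyProfinite 𝓕 → ClosedUnderDisjointUnions 𝓕 → ClosedUnderSummands 𝓕 →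
    HomDistinguishingClosed 𝓕)
    ×
    ((𝓕 : Pred SimpleGraph ℓ) → 𝓕 Respects _≅_ →
    EssentiallyProfinite 𝓕 → ClosedUnderMinors 𝓕 → ClosedUnderDisjointUnions 𝓕 →
    HomDistinguishingClosed 𝓕)
theorem3 = summandClosed⇒homDistinguishingClosed
         , λ 𝓕 resp profinite minors unions →
             summandClosed⇒homDistinguishingClosed 𝓕 resp profinite unions (minorClosed⇒summandClosed 𝓕 minors)
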